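{- Let $T$ be a $6$-tournament. The following are equivalent: (i) $\det(T)=25$; (ii) $\delta_T=5$; (iii) $T$ is switching equivalent to $L_6$; (iv) $T\in\mathcal{D}_5\setminus\mathcal{D}_3$.
   Context: A tournament is a directed graph with exactly one arc between each pair of distinct vertices; $u\rightarrow v$ means the arc goes from $u$ to $v$; a $6$-tournament has 6 vertices. For a tournament $T$ on vertices $v_1,\dots,v_n$, its skew-adjacency matrix is the zero-diagonal matrix $S_T=[s_{ij}]$ with $s_{ij}=-s_{ji}=1$ if $v_i\rightarrow v_j$, and $\det(T):=\det(S_T)$. A subtournament is the tournament induced by a nonempty vertex subset (including $T$ itself). For a positive odd integer $k$, $\mathcal{D}_k$ is the set of tournaments all of whose subtournaments have determinant at most $k^2$. A diamond is a 4-tournament consisting of a directed 3-cycle together with a vertex that either dominates all three cycle vertices or is dominated by all three; $\delta_T$ is the number of 4-vertex subsets of $V(T)$ inducing a diamond. The switch of $T$ with respect to $W\subseteq V(T)$ reverses all arcs between $W$ and $V(T)\setminus W$; switching equivalent means one is a switch of the other. $L_6$ is the tournament on vertices $u_1,\dots,u_6$ with $u_i\rightarrow u_j$ for $1\le i<j\le 5$, $u_6\rightarrow u_1,u_3,u_5$ and $u_2,u_4\rightarrow u_6$; "switching equivalent to $L_6$" means switching equivalent to a tournament isomorphic to $L_6$. -}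

module Defs where

open import Data.Bool using (Bool; true; false; not; _∧_; _∨_; if_then_else_; _xor_)
open import Data.Nat as ℕ using (ℕ; zero; suc; _<ᵇ_; _≡ᵇ_)
open import Data.Integer as ℤ using (ℤ; +_; -_; 0ℤ; 1ℤ)
open import Data.Fin using (Fin; zero; suc; toℕ; punchIn; _≟_)
open import Data.Fin.Permutation using (Permutation′; _⟨$⟩ʳ_)
open import Data.List using (List; []; _∷_; allFin; foldr; concatMap; filter; length; map)
open import Data.Product using (Σ; ∃; _×_; _,_)
open import Relation.Binary.PropositionalEquality using (_≡_; _≢_)
open import Relation.Nullary using (yes; no)
open import Relation.Nullary.Decidable using (does)
open import Function.Definitions using (Injective)

record Tournament (n : ℕ) : Set where
  field
    beats   : Fin n → Fin n → Bool
    irrefl  : ∀ i → beats i i ≡ false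
    tourn   : ∀ i j → i ≢ j → beats i j ≡ not (beats j i)
open Tournament public

Matrix : ℕ → Set
Matrix n = Fin n → Fin n → ℤ

sign : ℕ → ℤ
sign zero          = 1ℤ
sign (suc zero)    = - 1ℤ
sign (suc (suc k)) = sign k

minor : ∀ {n} → Matrix (suc n) → Fin (suc n) → Matrix n
minor M j r c = M (suc r) (punchIn j c)

det : ∀ {n} → Matrix n → ℤ
det {zero}  M = 1ℤ
det {suc n} M =
  foldr ℤ._+_ 0ℤ
    (map (λ j → sign (toℕ j) ℤ.* (M zero j ℤ.* det (minor M j))) (allFin (suc n)))

skew : ∀ {n} → Tournament n → Matrix n
skew T i j with does (i ≟ j)
... | true  = 0ℤ
... | false = if beats T i j then 1ℤ else - 1ℤ

detT : ∀ {n} → Tournament n → ℤ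
detT T = det (skew T)

-- Subtournaments.  A subtournament on m vertices is given by an
-- injective enumeration f : Fin m → Fin n of its vertex set; its
-- skew-adjacency matrix is the principal submatrix of S_T.

subDet : ∀ {n m} → Tournament n → (Fin m → Fin n) → ℤ
subDet T f = det (λ i j → skew T (f i) (f j))

InD : ℕ → ∀ {n} → Tournament n → Set
InD k {n} T = ∀ (m : ℕ) (f : Fin (suc m) → Fin n) → Injective _≡_ _≡_ f →
              subDet T f ℤ.≤ + (k ℕ.* k)

cyc3 : ∀ {n} → Tournament n → Fin n → Fin n → Fin n → Bool
cyc3 T a b c =
  (beats T a b ∧ beats T b c ∧ beats T c a) ∨ (beats T a c ∧ beats T c b ∧ beats T b a)

domAll : ∀ {n} → Tournament n → Fin n → Fin n → Fin n → Fin n → Bool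
domAll T x a b c =
  (beats T x a ∧ beats T x b ∧ beats T x c) ∨ (beats T a x ∧ beats T b x ∧ beats T c x)

isDiamond : ∀ {n} → Tournament n → Fin n → Fin n → Fin n → Fin n → Bool
isDiamond T a b c d =
     (cyc3 T b c d ∧ domAll T a b c d)
  ∨ (cyc3 T a c d ∧ domAll T b a c d)
  ∨ (cyc3 T a b d ∧ domAll T c a b d)
  ∨ (cyc3 T a b c ∧ domAll T d a b c)

_<F_ : ∀ {n} → Fin n → Fin n → Bool
i <F j = toℕ i <ᵇ toℕ j

quads : ∀ n → List (Fin n × Fin n × Fin n × Fin n)
quads n =
  concatMap (λ a → concatMap (λ b → concatMap (λ c → concatMap (λ d →
    if (a <F b) ∧ (b <F c) ∧ (c <F d) then (a , b , c , d) ∷ [] else [])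
    (allFin n)) (allFin n)) (allFin n)) (allFin n)

count : ∀ {A : Set} → (A → Bool) → List A → ℕ
count p []       = 0
count p (x ∷ xs) = (if p x then 1 else 0) ℕ.+ count p xs

δ : ∀ {n} → Tournament n → ℕ
δ {n} T = count (λ { (a , b , c , d) → isDiamond T a b c d }) (quads n)

switchRel : ∀ {n} → (Fin n → Fin n → Bool) → (Fin n → Bool) → Fin n → Fin n → Bool
switchRel r W i j = if W i xor W j then not (r i j) else r i j

-- L_6 on vertices u_1..u_6, encoded as 0..5
L6beats : Fin 6 → Fin 6 → Bool
L6beats i j = go (toℕ i) (toℕ j)
  where
  go : ℕ → ℕ → Bool
  go 5 j = (j ≡ᵇ 0) ∨ (j ≡ᵇ 2) ∨ (j ≡ᵇ 4)
  go i 5 = (i ≡ᵇ 1) ∨ (i ≡ᵇ 3)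
  go i j = i <ᵇ j

SwitchEquivL6 : Tournament 6 → Set
SwitchEquivL6 T =
  Σ (Fin 6 → Bool) λ W → Σ (Permutation′ 6) λ σ →
    ∀ i j → i ≢ j → switchRel (beats T) W (σ ⟨$⟩ʳ i) (σ ⟨$⟩ʳ j) ≡ L6beats i j

{-# OPTIONS --safe #-}
module Submission where

-- The determinant and the diamonds are invariant under switching, so one may
-- assume that vertex 0 beats all others; this leaves 2¹⁰ tournaments.  Inspecting
-- them shows that either det = 25, δ = 5 and an explicit switching to L₆ exists,
-- or δ ≠ 5 and det lies outside (9, 25].  The converse from (iii) to (ii) needs δ
-- only on the 720 relabellings of L₆.  Tournaments on at most 5 vertices have
-- determinant at most 9, so membership in D₃ and D₅ is decided by the
-- 6-vertex enumerations of T, to which the same dichotomy applies.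

open import Defs
open import Algebra.Bundles using (CommutativeSemiring)
import Algebra.Properties.CommutativeMonoid.Sum as CommutativeMonoidSum
open import Data.Bool as Bool using (Bool; true; false; not; if_then_else_; _xor_)
open import Data.Bool.Properties as Bool using (not-involutive)
open import Data.Bool.Solver using (module xor-∧-Solver)
open import Data.Fin using (Fin; zero; suc; toℕ; punchIn; punchOut; _≟_)
open import Data.Fin.Patterns using (0F; 1F; 2F; 3F; 4F; 5F)
open import Data.Fin.Permutation using (Permutation′; permutation; _⟨$⟩ʳ_; _⟨$⟩ˡ_; inverseˡ; inverseʳ; flip; _∘ₚ_)
open import Data.Fin.Properties using (all?; any?; suc-injective; punchOut-injective; injective⇒≤; <⇒notInjective)
open import Data.Integer as ℤ using (ℤ; +_; -_; 0ℤ; 1ℤ; _+_; _*_; _-_; +≤+)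
open import Data.Integer.Properties as ℤ using ()
open import Data.Integer.Solver using (module +-*-Solver)
open import Data.List as List using (List; []; _∷_; foldr; map; allFin)
open import Data.List.Properties using (map-tabulate)
open import Data.List.Relation.Unary.All as All using (All; []; _∷_)
open import Data.Nat as ℕ using (ℕ; zero; suc; s≤s)
open import Data.Nat.Properties as ℕ using ()
open import Data.Product using (_×_; _,_; proj₁; proj₂; ∃-syntax; uncurry)
open import Data.Sum as Sum using (_⊎_; inj₁; inj₂)
open import Data.Unit using (⊤; tt)
open import Data.Vec using (Vec; []; _∷_; lookup; tabulate; replicate)
open import Data.Vec.Properties using (lookup∘tabulate; lookup-replicate)
open import Data.Vec.Relation.Unary.All as VecAll using ()
open import Data.Vec.Relation.Unary.AllPairs using ([]; _∷_; allPairs?)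
open import Data.Vec.Relation.Unary.Unique.Propositional using (Unique)
open import Data.Vec.Relation.Unary.Unique.Propositional.Properties using (tabulate⁺; lookup-injective)
open import Function using (_∘_; id; mk⇔; mk↣)
open import Function.Bundles using (_⇔_; _↣_; Injection)
open import Function.Definitions using (Injective)
open import Relation.Binary.PropositionalEquality using (_≡_; _≢_; refl; sym; trans; cong; cong₂; subst; subst₂; module ≡-Reasoning)
open import Relation.Nullary using (Dec; yes; no; does; ¬_; contradiction)
open import Relation.Nullary.Decidable using (map′; ¬?; _×-dec_; _⊎-dec_; _→-dec_; dec-true; dec-false)
open import Relation.Unary using (Decidable)
open import Algebra.Properties.Semiring.Sum (CommutativeSemiring.semiring ℤ.+-*-commutativeSemiring) using (sum; sum-cong-≗; *-distribˡ-sum)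

open Injection using () renaming (to to infixl 5 _↣$_)

-- The determinant as a wedge product

module Prod = CommutativeMonoidSum ℤ.*-1-commutativeMonoid

∏ : ∀ {n} → (Fin n → ℤ) → ℤ
∏ = Prod.sum

foldr-map-allFin : ∀ n (f : Fin n → ℤ) → foldr _+_ 0ℤ (map f (allFin n)) ≡ sum f
foldr-map-allFin zero    f = refl
foldr-map-allFin (suc n) f = cong (λ s → f zero + s) (begin
  foldr _+_ 0ℤ (map f (List.tabulate suc))      ≡⟨ cong (foldr _+_ 0ℤ) (map-tabulate suc f) ⟩
  foldr _+_ 0ℤ (List.tabulate (f ∘ suc))        ≡⟨ cong (foldr _+_ 0ℤ) (map-tabulate id (f ∘ suc)) ⟨
  foldr _+_ 0ℤ (map (f ∘ suc) (allFin n))       ≡⟨ foldr-map-allFin n (f ∘ suc) ⟩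
  sum (f ∘ suc)                                 ∎)
  where open ≡-Reasoning

laplaceTerm : ∀ {n} → Matrix (suc n) → Fin (suc n) → ℤ
laplaceTerm M j = sign (toℕ j) * (M zero j * det (minor M j))

laplace : ∀ {n} (M : Matrix (suc n)) → det M ≡ sum (laplaceTerm M)
laplace {n} M = foldr-map-allFin (suc n) (laplaceTerm M)

det-cong : ∀ {n} {M N : Matrix n} → (∀ i j → M i j ≡ N i j) → det M ≡ det N
det-cong {zero}  M≗N = refl
det-cong {suc n} {M} {N} M≗N = begin
  det M                  ≡⟨ laplace M ⟩
  sum (laplaceTerm M)    ≡⟨ sum-cong-≗ (λ j → cong (sign (toℕ j) *_) (cong₂ _*_ (M≗N zero j)
                              (det-cong (λ r c → M≗N (suc r) (punchIn j c))))) ⟩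
  sum (laplaceTerm N)    ≡⟨ laplace N ⟨
  det N                  ∎
  where open ≡-Reasoning

-- In the `j`-th Laplace term, the row factor `d zero` and the column factor `e j` are exactly those
-- missing from the products that induction extracts from the minor.
det-scale : ∀ {n} (d e : Fin n → ℤ) (M : Matrix n) →
  det (λ i j → d i * (M i j * e j)) ≡ (∏ d * ∏ e) * det M
det-scale {zero}  d e M = refl
det-scale {suc n} d e M = begin
  det M′                                       ≡⟨ laplace M′ ⟩
  sum (laplaceTerm M′)                         ≡⟨ sum-cong-≗ term ⟩
  sum (λ j → (∏ d * ∏ e) * laplaceTerm M j)    ≡⟨ *-distribˡ-sum (∏ d * ∏ e) (laplaceTerm M) ⟨
  (∏ d * ∏ e) * sum (laplaceTerm M)            ≡⟨ cong ((∏ d * ∏ e) *_) (laplace M) ⟨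
  (∏ d * ∏ e) * det M                          ∎
  where
  open ≡-Reasoning
  open +-*-Solver
  M′ : Matrix (suc n)
  M′ i j = d i * (M i j * e j)
  term : ∀ j → laplaceTerm M′ j ≡ (∏ d * ∏ e) * laplaceTerm M j
  term j = begin
    s * ((d zero * (m * e j)) * det (minor M′ j))
      ≡⟨ cong (λ x → s * ((d zero * (m * e j)) * x)) (det-scale (d ∘ suc) e′ (minor M j)) ⟩
    s * ((d zero * (m * e j)) * ((∏ (d ∘ suc) * ∏ e′) * D))
      ≡⟨ solve 7 (λ s d₀ m eⱼ ∏d ∏e D →
           s :* ((d₀ :* (m :* eⱼ)) :* ((∏d :* ∏e) :* D)) :=
           ((d₀ :* ∏d) :* (eⱼ :* ∏e)) :* (s :* (m :* D)))
         refl s (d zero) m (e j) (∏ (d ∘ suc)) (∏ e′) D ⟩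
    (∏ d * (e j * ∏ e′)) * laplaceTerm M j
      ≡⟨ cong (λ x → (∏ d * x) * laplaceTerm M j) (Prod.sum-remove {i = j} e) ⟨
    (∏ d * ∏ e) * laplaceTerm M j ∎
    where
    s = sign (toℕ j)
    m = M zero j
    e′ = e ∘ punchIn j
    D = det (minor M j)

∏-involutive : ∀ {n} (d : Fin n → ℤ) → (∀ i → d i * d i ≡ 1ℤ) → ∏ d * ∏ d ≡ 1ℤ
∏-involutive {zero}  d d² = refl
∏-involutive {suc n} d d² = begin
  (d zero * p) * (d zero * p)      ≡⟨ solve 2 (λ x y → (x :* y) :* (x :* y) := (x :* x) :* (y :* y)) refl (d zero) p ⟩
  (d zero * d zero) * (p * p)      ≡⟨ cong₂ _*_ (d² zero) (∏-involutive (d ∘ suc) (d² ∘ suc)) ⟩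
  1ℤ                               ∎
  where
  open ≡-Reasoning
  open +-*-Solver
  p = ∏ (d ∘ suc)

-- Λ n k holds the coefficients of a k-form on ℤⁿ: in positive dimension and
-- degree, (p , q) stands for p + e₀ ∧ q with p and q free of e₀.  The
-- determinant is evaluated as the wedge product of the rows, which shares
-- the subminors that the Laplace expansion recomputes.
Λ : ℕ → ℕ → Set
Λ n       zero    = ℤ
Λ zero    (suc k) = ⊤
Λ (suc n) (suc k) = Λ n (suc k) × Λ n k

_·_⊖_ : ∀ {n k} → ℤ → Λ n k → Λ n k → Λ n k
_·_⊖_ {n}     {zero}  x c       c′        = x * c - c′
_·_⊖_ {zero}  {suc k} x tt      tt        = tt
_·_⊖_ {suc n} {suc k} x (p , q) (p′ , q′) = (x · p ⊖ p′) , (x · q ⊖ q′)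

-- Write v = v₀ e₀ + v′. Since v′ anticommutes with e₀, v ∧ (p + e₀ ∧ q) = v′ ∧ p + e₀ ∧ (v₀ p - v′
-- ∧ q).
wedge : ∀ {n k} → (Fin n → ℤ) → Λ n k → Λ n (suc k)
wedge {zero}          v ω       = tt
wedge {suc n} {zero}  v c       = wedge (v ∘ suc) c , v zero * c
wedge {suc n} {suc k} v (p , q) = wedge (v ∘ suc) p , (v zero · p ⊖ wedge (v ∘ suc) q)

rowWedge : ∀ {n k} → (Fin k → Fin n → ℤ) → Λ n k
rowWedge {k = zero}  M = 1ℤ
rowWedge {k = suc k} M = wedge (M zero) (rowWedge (M ∘ suc))

top : ∀ {n} → Λ n n → ℤ
top {zero}  c       = c
top {suc n} (p , q) = top q

-- Restriction to the hyperplane on which the j-th coordinate vanishes.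
restrict : ∀ {n k} → Fin (suc n) → Λ (suc n) k → Λ n k
restrict {k = zero}          j       c       = c
restrict {k = suc k}         zero    (p , q) = p
restrict {suc n} {k = suc k} (suc j) (p , q) = restrict j p , restrict j q

restrict-⊖ : ∀ {n k} (j : Fin (suc n)) x (p q : Λ (suc n) k) →
  restrict j (x · p ⊖ q) ≡ x · restrict j p ⊖ restrict j q
restrict-⊖ {k = zero}          j       x p q = refl
restrict-⊖ {k = suc k}         zero    x p q = refl
restrict-⊖ {suc n} {k = suc k} (suc j) x (p , q) (p′ , q′) =
  cong₂ _,_ (restrict-⊖ j x p p′) (restrict-⊖ j x q q′)

-- Restriction is the pullback of forms along the inclusion of a coordinate hyperplane, hence
-- multiplicative. It turns deleting column `j` into an operation on the wedge of the rows.
restrict-wedge : ∀ {n k} (j : Fin (suc n)) (v : Fin (suc n) → ℤ) (ω : Λ (suc n) k) →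
  restrict j (wedge v ω) ≡ wedge (v ∘ punchIn j) (restrict j ω)
restrict-wedge {k = zero}          zero    v c = refl
restrict-wedge {suc n} {zero}      (suc j) v c = cong (_, v zero * c) (restrict-wedge j (v ∘ suc) c)
restrict-wedge {k = suc k}         zero    v (p , q) = refl
restrict-wedge {suc n} {suc k}     (suc j) v (p , q) =
  cong₂ _,_ (restrict-wedge j (v ∘ suc) p)
    (trans (restrict-⊖ j (v zero) p (wedge (v ∘ suc) q))
           (cong (v zero · restrict j p ⊖_) (restrict-wedge j (v ∘ suc) q)))

restrict-rowWedge : ∀ {n k} (j : Fin (suc n)) (M : Fin k → Fin (suc n) → ℤ) →
  restrict j (rowWedge M) ≡ rowWedge (λ r c → M r (punchIn j c))
restrict-rowWedge {k = zero}  j M = refl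
restrict-rowWedge {k = suc k} j M =
  trans (restrict-wedge j (M zero) (rowWedge (M ∘ suc)))
        (cong (wedge (M zero ∘ punchIn j)) (restrict-rowWedge j (M ∘ suc)))

top-⊖ : ∀ {n} x (p q : Λ n n) → top (x · p ⊖ q) ≡ x * top p - top q
top-⊖ {zero}  x p q = refl
top-⊖ {suc n} x (_ , p) (_ , q) = top-⊖ x p q

sign-suc : ∀ n → sign (suc n) ≡ - 1ℤ * sign n
sign-suc zero          = refl
sign-suc (suc zero)    = refl
sign-suc (suc (suc n)) = sign-suc n

-- The coefficient of ω that omits e_j survives on the hyperplane x_j = 0, and moving e_j into place
-- costs the sign. In the recursion, `p` supplies the term j = 0 and `q` the others, whose signs are
-- flipped by the subtraction.
top-wedge : ∀ {n} (v : Fin (suc n) → ℤ) (ω : Λ (suc n) n) →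
  top (wedge v ω) ≡ sum (λ j → sign (toℕ j) * (v j * top (restrict j ω)))
top-wedge {zero}  v c = solve 1 (λ x → x := con 1ℤ :* x :+ con 0ℤ) refl (v zero * c)
  where open +-*-Solver
top-wedge {suc n} v (p , q) = begin
  top (v zero · p ⊖ wedge v′ q)
    ≡⟨ top-⊖ (v zero) p (wedge v′ q) ⟩
  v zero * top p - top (wedge v′ q)
    ≡⟨ cong (λ x → v zero * top p - x) (top-wedge v′ q) ⟩
  v zero * top p - sum t
    ≡⟨ solve 2 (λ x y → x :- y := con 1ℤ :* x :+ con (- 1ℤ) :* y) refl (v zero * top p) (sum t) ⟩
  1ℤ * (v zero * top p) + - 1ℤ * sum t
    ≡⟨ cong (λ s → 1ℤ * (v zero * top p) + s) (*-distribˡ-sum (- 1ℤ) t) ⟩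
  1ℤ * (v zero * top p) + sum (λ j → - 1ℤ * t j)
    ≡⟨ cong (λ s → 1ℤ * (v zero * top p) + s) (sum-cong-≗ flipSign) ⟩
  1ℤ * (v zero * top p) + sum (λ j → sign (suc (toℕ j)) * (v′ j * top (restrict j q))) ∎
  where
  open ≡-Reasoning
  open +-*-Solver
  v′ = v ∘ suc
  t : Fin (suc n) → ℤ
  t j = sign (toℕ j) * (v′ j * top (restrict j q))
  flipSign : ∀ j → - 1ℤ * t j ≡ sign (suc (toℕ j)) * (v′ j * top (restrict j q))
  flipSign j = trans (sym (ℤ.*-assoc (- 1ℤ) (sign (toℕ j)) (v′ j * top (restrict j q))))
                     (cong (_* (v′ j * top (restrict j q))) (sym (sign-suc (toℕ j))))

det≡top : ∀ {n} (M : Matrix n) → det M ≡ top (rowWedge M)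
det≡top {zero}  M = refl
det≡top {suc n} M = begin
  det M
    ≡⟨ laplace M ⟩
  sum (laplaceTerm M)
    ≡⟨ sum-cong-≗ (λ j → cong (λ x → sign (toℕ j) * (M zero j * x)) (det-minor j)) ⟩
  sum (λ j → sign (toℕ j) * (M zero j * top (restrict j ω)))
    ≡⟨ top-wedge (M zero) ω ⟨
  top (wedge (M zero) ω) ∎
  where
  open ≡-Reasoning
  ω = rowWedge (M ∘ suc)
  det-minor : ∀ j → det (minor M j) ≡ top (restrict j ω)
  det-minor j = trans (det≡top (minor M j)) (cong top (sym (restrict-rowWedge j (M ∘ suc))))

-- Codes of tournaments and switching

-- In (v , u), v records which later vertices the first one beats and u codes the rest.
Upper : ℕ → Set
Upper zero    = ⊤
Upper (suc n) = Vec Bool n × Upper n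

upperRel : ∀ {n} → Upper n → Fin n → Fin n → Bool
upperRel (v , u) zero    zero    = false
upperRel (v , u) zero    (suc j) = lookup v j
upperRel (v , u) (suc i) zero    = not (lookup v i)
upperRel (v , u) (suc i) (suc j) = upperRel u i j

decode : ∀ {n} → Upper n → Tournament n
decode u .beats   = upperRel u
decode {suc n} u .irrefl zero    = refl
decode {suc n} u .irrefl (suc i) = decode (proj₂ u) .irrefl i
decode {suc n} u .tourn zero    zero    0≢0 = contradiction refl 0≢0
decode {suc n} u .tourn zero    (suc j) _   = sym (not-involutive _)
decode {suc n} u .tourn (suc i) zero    _   = refl
decode {suc n} u .tourn (suc i) (suc j) i≢j = decode (proj₂ u) .tourn i j (i≢j ∘ cong suc)

-- Only entries above the diagonal are read, so a bare relation suffices; for a tournament the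
-- remaining entries are determined by these.
encode : ∀ {n} → (Fin n → Fin n → Bool) → Upper n
encode {zero}  r = tt
encode {suc n} r = tabulate (r zero ∘ suc) , encode (λ i j → r (suc i) (suc j))

pull : ∀ {m n} → Tournament n → Fin m ↣ Fin n → Tournament m
pull T f .beats i j       = beats T (f ↣$ i) (f ↣$ j)
pull T f .irrefl i        = irrefl T (f ↣$ i)
pull T f .tourn i j i≢j   = tourn T (f ↣$ i) (f ↣$ j) (i≢j ∘ Injection.injective f)

_≗ᵀ_ : ∀ {n} → Tournament n → Tournament n → Set
T ≗ᵀ S = ∀ i j → beats T i j ≡ beats S i j

decode-encode : ∀ {n} (T : Tournament n) → decode (encode (beats T)) ≗ᵀ T
decode-encode {suc n} T zero    zero    = sym (irrefl T zero)
decode-encode {suc n} T zero    (suc j) = lookup∘tabulate _ j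
decode-encode {suc n} T (suc i) zero    =
  trans (cong not (lookup∘tabulate _ i)) (sym (tourn T (suc i) zero λ ()))
decode-encode {suc n} T (suc i) (suc j) = decode-encode (pull T (mk↣ suc-injective)) i j

cone : ∀ {n} → Upper n → Tournament (suc n)
cone u = decode (replicate _ true , u)

switch : ∀ {n} → Tournament n → (Fin n → Bool) → Tournament n
switch T W .beats = switchRel (beats T) W
switch T W .irrefl i with W i
... | true  = irrefl T i
... | false = irrefl T i
switch T W .tourn i j i≢j with W i | W j
... | true  | true  = tourn T i j i≢j
... | true  | false = cong not (tourn T i j i≢j)
... | false | true  = cong not (tourn T i j i≢j)
... | false | false = tourn T i j i≢j

sourceSwitch : ∀ {n} → Tournament (suc n) → Fin (suc n) → Bool
sourceSwitch T zero    = false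
sourceSwitch T (suc j) = not (beats T zero (suc j))

sourceCode : ∀ {n} → Tournament (suc n) → Upper n
sourceCode T = encode (λ i j → switchRel (beats T) (sourceSwitch T) (suc i) (suc j))

switch-source : ∀ {n} (T : Tournament (suc n)) j → switchRel (beats T) (sourceSwitch T) zero (suc j) ≡ true
switch-source T j with beats T zero (suc j)
... | true  = refl
... | false = refl

switch≗cone : ∀ {n} (T : Tournament (suc n)) → switch T (sourceSwitch T) ≗ᵀ cone (sourceCode T)
switch≗cone T zero    zero    = irrefl T zero
switch≗cone T zero    (suc j) = trans (switch-source T j) (sym (lookup-replicate j true))
switch≗cone T (suc i) zero    =
  trans (tourn (switch T (sourceSwitch T)) (suc i) zero λ ())
        (cong not (trans (switch-source T i) (sym (lookup-replicate i true))))
switch≗cone T (suc i) (suc j) =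
  sym (decode-encode (pull (switch T (sourceSwitch T)) (mk↣ suc-injective)) i j)

-- Skew-adjacency matrices and the switching invariance of the determinant

skew-diagonal : ∀ {n} (T : Tournament n) i → skew T i i ≡ 0ℤ
skew-diagonal T i rewrite dec-true (i ≟ i) refl = refl

skew-off-diagonal : ∀ {n} (T : Tournament n) {i j} → i ≢ j → skew T i j ≡ (if beats T i j then 1ℤ else - 1ℤ)
skew-off-diagonal T {i} {j} i≢j rewrite dec-false (i ≟ j) i≢j = refl

skew-cong : ∀ {n} {T S : Tournament n} → T ≗ᵀ S → ∀ i j → skew T i j ≡ skew S i j
skew-cong T≗S i j with does (i ≟ j)
... | true  = refl
... | false = cong (if_then 1ℤ else - 1ℤ) (T≗S i j)

detT-cong : ∀ {n} {T S : Tournament n} → T ≗ᵀ S → detT T ≡ detT S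
detT-cong {T = T} {S} T≗S = det-cong (skew-cong {T = T} {S} T≗S)

skew-pull : ∀ {m n} (T : Tournament n) (f : Fin m ↣ Fin n) i j →
  skew T (f ↣$ i) (f ↣$ j) ≡ skew (pull T f) i j
skew-pull T f i j with i ≟ j
... | yes refl = skew-diagonal T (f ↣$ i)
... | no i≢j   = skew-off-diagonal T (i≢j ∘ Injection.injective f)

subDet-pull : ∀ {m n} (T : Tournament n) (f : Fin m ↣ Fin n) → subDet T (f ↣$_) ≡ detT (pull T f)
subDet-pull T f = det-cong (skew-pull T f)

switchSign : Bool → ℤ
switchSign b = if b then - 1ℤ else 1ℤ

-- Switching conjugates the skew-adjacency matrix by a diagonal matrix of signs, whose determinant
-- squares to 1.
skew-switch : ∀ {n} (T : Tournament n) (W : Fin n → Bool) i j →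
  skew (switch T W) i j ≡ switchSign (W i) * (skew T i j * switchSign (W j))
skew-switch T W i j with does (i ≟ j)
... | false = arc (W i) (W j) (beats T i j)
  where
  arc : ∀ x y b → (if (if x xor y then not b else b) then 1ℤ else - 1ℤ) ≡
    switchSign x * ((if b then 1ℤ else - 1ℤ) * switchSign y)
  arc true  true  true  = refl
  arc true  true  false = refl
  arc true  false true  = refl
  arc true  false false = refl
  arc false true  true  = refl
  arc false true  false = refl
  arc false false true  = refl
  arc false false false = refl
... | true  = sym (trans (cong (switchSign (W i) *_) (ℤ.*-zeroˡ (switchSign (W j))))
                         (ℤ.*-zeroʳ (switchSign (W i))))

detT-switch : ∀ {n} (T : Tournament n) (W : Fin n → Bool) → detT (switch T W) ≡ detT T
detT-switch T W = begin
  det (skew (switch T W))                                ≡⟨ det-cong (skew-switch T W) ⟩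
  det (λ i j → w i * (skew T i j * w j))                 ≡⟨ det-scale w w (skew T) ⟩
  (∏ w * ∏ w) * det (skew T)                             ≡⟨ cong (_* detT T) (∏-involutive w (w² ∘ W)) ⟩
  1ℤ * det (skew T)                                      ≡⟨ ℤ.*-identityˡ (detT T) ⟩
  det (skew T)                                           ∎
  where
  open ≡-Reasoning
  w = switchSign ∘ W
  w² : ∀ b → switchSign b * switchSign b ≡ 1ℤ
  w² true  = refl
  w² false = refl

detT-cone : ∀ {n} (T : Tournament (suc n)) → detT T ≡ detT (cone (sourceCode T))
detT-cone T = trans (sym (detT-switch T (sourceSwitch T))) (detT-cong (switch≗cone T))

-- Exhaustive decision over codes

allVec? : ∀ {n} {P : Vec Bool n → Set} → Decidable P → Dec (∀ v → P v)
allVec? {zero}  P? = map′ (λ { p [] → p }) (λ f → f []) (P? [])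
allVec? {suc n} P? =
  map′ (λ { (p , q) (true ∷ v) → p v ; (p , q) (false ∷ v) → q v })
       (λ f → (λ v → f (true ∷ v)) , (λ v → f (false ∷ v)))
       (allVec? (P? ∘ (true ∷_)) ×-dec allVec? (P? ∘ (false ∷_)))

allUpper? : ∀ {n} {P : Upper n → Set} → Decidable P → Dec (∀ u → P u)
allUpper? {zero}  P? = map′ (λ p _ → p) (λ f → f tt) (P? tt)
allUpper? {suc n} P? = map′ (λ { f (v , u) → f v u }) (λ f v u → f (v , u))
                            (allVec? λ v → allUpper? λ u → P? (v , u))

-- Unlike from-yes, this forces only the boolean part of the decision, so that large
-- case checks do not retain the proofs attached to each case.
decide : ∀ {A : Set} (A? : Dec A) → does A? ≡ true → A
decide (yes a) _ = a

-- Diamonds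

isDiamond-cong : ∀ {n} (T S : Tournament n) → T ≗ᵀ S → ∀ a b c d → isDiamond T a b c d ≡ isDiamond S a b c d
isDiamond-cong T S e a b c d
  rewrite e a b | e a c | e a d | e b a | e b c | e b d | e c a | e c b | e c d | e d a | e d b | e d c = refl

-- A check of 64 codes against 16 switching sets. Conceptually, diamonds are the 4-tournaments of
-- determinant 9, and switching preserves the determinant.
isDiamond-switch₄ : ∀ (u : Upper 4) (W : Vec Bool 4) →
  isDiamond (switch (decode u) (lookup W)) 0F 1F 2F 3F ≡ isDiamond (decode u) 0F 1F 2F 3F
isDiamond-switch₄ = decide (allUpper? {4} λ u → allVec? {4} λ W →
  isDiamond (switch (decode u) (lookup W)) 0F 1F 2F 3F Bool.≟ isDiamond (decode u) 0F 1F 2F 3F) refl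

-- Four distinct vertices form an embedding of `Fin 4`; pulling both the tournament and the
-- switching set back along it leaves the finite check on four vertices.
isDiamond-switch : ∀ {n} (T : Tournament n) (W : Fin n → Bool) {a b c d} → Unique (a ∷ b ∷ c ∷ d ∷ []) →
  isDiamond (switch T W) a b c d ≡ isDiamond T a b c d
isDiamond-switch T W {a} {b} {c} {d} distinct = begin
  isDiamond (switch T W) a b c d
    ≡⟨ isDiamond-cong (switch (decode u) (lookup V)) Sᶠ switched 0F 1F 2F 3F ⟨
  isDiamond (switch (decode u) (lookup V)) 0F 1F 2F 3F
    ≡⟨ isDiamond-switch₄ u V ⟩
  isDiamond (decode u) 0F 1F 2F 3F
    ≡⟨ isDiamond-cong (decode u) Tᶠ (decode-encode Tᶠ) 0F 1F 2F 3F ⟩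
  isDiamond T a b c d ∎
  where
  open ≡-Reasoning
  f : Fin 4 ↣ Fin _
  f = mk↣ (lookup-injective distinct _ _)
  Tᶠ = pull T f
  Sᶠ = pull (switch T W) f
  u = encode (beats Tᶠ)
  V = tabulate (W ∘ (f ↣$_))
  switched : switch (decode u) (lookup V) ≗ᵀ Sᶠ
  switched i j rewrite lookup∘tabulate (W ∘ (f ↣$_)) i | lookup∘tabulate (W ∘ (f ↣$_)) j | decode-encode Tᶠ i j = refl

diamondAt : ∀ {n} → Tournament n → Fin n × Fin n × Fin n × Fin n → Bool
diamondAt T (a , b , c , d) = isDiamond T a b c d

Distinct : ∀ {n} → Fin n × Fin n × Fin n × Fin n → Set
Distinct (a , b , c , d) = Unique (a ∷ b ∷ c ∷ d ∷ [])

count-cong : ∀ {A : Set} {p q : A → Bool} {xs : List A} → All (λ x → p x ≡ q x) xs → count p xs ≡ count q xs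
count-cong []         = refl
count-cong (e ∷ es)   = cong₂ (λ b k → (if b then 1 else 0) ℕ.+ k) e (count-cong es)

-- The value of `quads 6` written out, so that the finite checks do not filter all 6⁴ tuples again
-- in each case.
quads₆ : List (Fin 6 × Fin 6 × Fin 6 × Fin 6)
quads₆ = (0F , 1F , 2F , 3F) ∷ (0F , 1F , 2F , 4F) ∷ (0F , 1F , 2F , 5F) ∷ (0F , 1F , 3F , 4F) ∷ (0F , 1F , 3F , 5F)
       ∷ (0F , 1F , 4F , 5F) ∷ (0F , 2F , 3F , 4F) ∷ (0F , 2F , 3F , 5F) ∷ (0F , 2F , 4F , 5F) ∷ (0F , 3F , 4F , 5F)
       ∷ (1F , 2F , 3F , 4F) ∷ (1F , 2F , 3F , 5F) ∷ (1F , 2F , 4F , 5F) ∷ (1F , 3F , 4F , 5F) ∷ (2F , 3F , 4F , 5F) ∷ []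

δ₆ : Tournament 6 → ℕ
δ₆ T = count (diamondAt T) quads₆

δ≡δ₆ : ∀ T → δ T ≡ δ₆ T
δ≡δ₆ T = refl

unique? : ∀ {m n} → Decidable (Unique {A = Fin n} {n = m})
unique? = allPairs? (λ x y → ¬? (x ≟ y))

quads₆-distinct : All Distinct quads₆
quads₆-distinct = decide (All.all? (λ { (a , b , c , d) → unique? (a ∷ b ∷ c ∷ d ∷ []) }) quads₆) refl

δ₆-cong : ∀ T S → T ≗ᵀ S → δ₆ T ≡ δ₆ S
δ₆-cong T S T≗S = count-cong (All.universal (λ { (a , b , c , d) → isDiamond-cong T S T≗S a b c d }) quads₆)

δ₆-switch : ∀ T W → δ₆ (switch T W) ≡ δ₆ T
δ₆-switch T W = count-cong (All.map (isDiamond-switch T W) quads₆-distinct)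

δ₆-cone : ∀ T → δ₆ T ≡ δ₆ (cone (sourceCode T))
δ₆-cone T = trans (sym (δ₆-switch T (sourceSwitch T)))
  (δ₆-cong (switch T (sourceSwitch T)) (cone (sourceCode T)) (switch≗cone T))

-- Permutations and the relabellings of L₆

injective⇒surjective : ∀ {n} (f : Fin n → Fin n) → Injective _≡_ _≡_ f → ∀ y → ∃[ x ] f x ≡ y
injective⇒surjective {suc n} f f-inj y with any? (λ x → f x ≟ y)
... | yes hit  = hit
-- If `y` were missed, punching it out would inject `Fin (suc n)` into `Fin n`.
... | no  miss = contradiction
  (λ {i} {j} → f-inj ∘ punchOut-injective (λ e → miss (i , sym e)) (λ e → miss (j , sym e)))
  (<⇒notInjective {f = λ i → punchOut {i = y} {f i} (λ e → miss (i , sym e))} ℕ.≤-refl)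

injection⇒permutation : ∀ {n} (f : Fin n ↣ Fin n) → ∃[ π ] ∀ i → π ⟨$⟩ʳ i ≡ f ↣$ i
injection⇒permutation f =
  permutation (f ↣$_) (proj₁ ∘ preimage) (proj₂ ∘ preimage) (λ i → inj (proj₂ (preimage (f ↣$ i)))) , λ _ → refl
  where
  inj = Injection.injective f
  preimage = injective⇒surjective (f ↣$_) inj

-- Only repetition-free tails are extended, and a head is tested against its tail before `P?` is
-- evaluated.
allUnique? : ∀ {m n} {P : Vec (Fin n) m → Set} → Decidable P → Dec (∀ v → Unique v → P v)
allUnique? {zero}  P? = map′ (λ { p [] [] → p }) (λ f → f [] []) (P? [])
allUnique? {suc m} P? =
  map′ (λ { f (x ∷ v) (x∉v ∷ v-unique) → f v v-unique x x∉v }) (λ f v v-unique x x∉v → f (x ∷ v) (x∉v ∷ v-unique))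
       (allUnique? λ v → all? λ x → VecAll.all? (λ y → ¬? (x ≟ y)) v →-dec P? (x ∷ v))

δ₆-L6 : ∀ (v : Vec (Fin 6) 6) → Unique v →
  δ₆ (decode (encode λ i j → L6beats (lookup v i) (lookup v j))) ≡ 5
δ₆-L6 = decide (allUnique? {6} {6} λ v →
  δ₆ (decode (encode λ i j → L6beats (lookup v i) (lookup v j))) ℕ.≟ 5) refl

L6-irrefl : ∀ i → L6beats i i ≡ false
L6-irrefl = decide (all? λ i → L6beats i i Bool.≟ false) refl

L6-tourn : ∀ i j → i ≢ j → L6beats i j ≡ not (L6beats j i)
L6-tourn = decide (all? λ i → all? λ j → ¬? (i ≟ j) →-dec (L6beats i j Bool.≟ not (L6beats j i))) refl

L6 : Tournament 6
L6 .beats  = L6beats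
L6 .irrefl = L6-irrefl
L6 .tourn  = L6-tourn

-- Switching equivalence with L₆

-- In this form the laws of xor apply to switchings.
switchRel-xor : ∀ {n} (r : Fin n → Fin n → Bool) W i j → switchRel r W i j ≡ (W i xor W j) xor r i j
switchRel-xor r W i j with W i xor W j
... | true  = refl
... | false = refl

-- The only switching that can turn T, read along g, into L₆ without touching u₆.
alignment : Tournament 6 → (Fin 6 → Fin 6) → Fin 6 → Bool
alignment T g i = beats T (g 5F) (g i) xor L6beats 5F i

Aligned : Tournament 6 → (Fin 6 → Fin 6) → Set
Aligned T g = ∀ i j → i ≢ j → switchRel (λ i j → beats T (g i) (g j)) (alignment T g) i j ≡ L6beats i j

aligned? : ∀ T g → Dec (Aligned T g)
aligned? T g = all? λ i → all? λ j → ¬? (i ≟ j) →-dec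
  (switchRel (λ i j → beats T (g i) (g j)) (alignment T g) i j Bool.≟ L6beats i j)

-- If `g` identified `i` and `j`, the switched relation would be symmetric on this pair, while L₆ is
-- antisymmetric. Hence the search need not test its vertices for distinctness.
aligned⇒injective : ∀ T g → Aligned T g → Injective _≡_ _≡_ g
aligned⇒injective T g aligned {i} {j} gi≡gj with i ≟ j
... | yes i≡j = i≡j
... | no  i≢j = contradiction (begin
  L6beats i j
    ≡⟨ aligned i j i≢j ⟨
  switchRel r V i j
    ≡⟨ switchRel-xor r V i j ⟩
  (V i xor V j) xor beats T (g i) (g j)
    ≡⟨ cong₂ _xor_ (Bool.xor-comm (V i) (V j)) (cong₂ (beats T) gi≡gj (sym gi≡gj)) ⟩
  (V j xor V i) xor beats T (g j) (g i)
    ≡⟨ switchRel-xor r V j i ⟨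
  switchRel r V j i
    ≡⟨ aligned j i (i≢j ∘ sym) ⟩
  L6beats j i ∎)
  (λ e → Bool.not-¬ e (L6-tourn i j i≢j))
  where
  open ≡-Reasoning
  r = λ i j → beats T (g i) (g j)
  V = alignment T g

aligned⇒switchEquivL6 : ∀ T g → Aligned T g → SwitchEquivL6 T
aligned⇒switchEquivL6 T g aligned with injection⇒permutation (mk↣ (aligned⇒injective T g aligned))
-- The alignment is indexed by the vertices of L₆; the inverse permutation carries it to those of
-- `T`.
... | π , π≗g = alignment T g ∘ (π ⟨$⟩ˡ_) , π , λ i j i≢j → trans (along i j) (aligned i j i≢j)
  where
  along : ∀ i j → switchRel (beats T) (alignment T g ∘ (π ⟨$⟩ˡ_)) (π ⟨$⟩ʳ i) (π ⟨$⟩ʳ j)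
    ≡ switchRel (λ i j → beats T (g i) (g j)) (alignment T g) i j
  along i j rewrite inverseˡ π {i} | inverseˡ π {j} | π≗g i | π≗g j = refl

-- Parities of triangles through u₆ are switching invariant; the search below
-- uses them to discard partial assignments.
Parity : Tournament 6 → Fin 6 → Fin 6 → Fin 6 → Fin 6 → Fin 6 → Set
Parity T a i b j c =
  (beats T a b xor beats T a c) xor beats T b c ≡ (L6beats 5F i xor L6beats 5F j) xor L6beats i j

parity? : ∀ T a i b j c → Dec (Parity T a i b j c)
parity? T a i b j c = _ Bool.≟ _

-- Up to switching, rotating u₁, …, u₅ is an automorphism of L₆, so u₁ can be
-- placed on any vertex that does not carry u₆.
besides : Fin 6 → Fin 6
besides zero    = 1F
besides (suc _) = 0F

-- Here `a` carries u₆, and `b`, `c`, `d`, `e`, `f` carry u₁, ..., u₅ in this order.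
Alignable : Tournament 6 → Set
Alignable T =
  ∃[ a ] let b = besides a in
  ∃[ c ] Parity T a 0F b 1F c ×
  ∃[ d ] (Parity T a 0F b 2F d × Parity T a 1F c 2F d) ×
  ∃[ e ] (Parity T a 0F b 3F e × Parity T a 1F c 3F e × Parity T a 2F d 3F e) ×
  ∃[ f ] Aligned T (lookup (b ∷ c ∷ d ∷ e ∷ f ∷ a ∷ []))

alignable? : ∀ T → Dec (Alignable T)
alignable? T =
  any? λ a → let b = besides a in
  any? λ c → parity? T a 0F b 1F c ×-dec
  any? λ d → (parity? T a 0F b 2F d ×-dec parity? T a 1F c 2F d) ×-dec
  any? λ e → (parity? T a 0F b 3F e ×-dec parity? T a 1F c 3F e ×-dec parity? T a 2F d 3F e) ×-dec
  any? λ f → aligned? T (lookup (b ∷ c ∷ d ∷ e ∷ f ∷ a ∷ []))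

alignable⇒switchEquivL6 : ∀ T → Alignable T → SwitchEquivL6 T
alignable⇒switchEquivL6 T (_ , _ , _ , _ , _ , _ , _ , _ , aligned) = aligned⇒switchEquivL6 T _ aligned

-- The dichotomy for 6-tournaments

data Dichotomy (A : Set) (d : ℤ) (k : ℕ) : Set where
  extremal : d ≡ + 25 → k ≡ 5 → A → Dichotomy A d k
  -- The negation of `A` is not recorded: for equivalence with L₆ it follows from `k ≢ 5`, as that
  -- equivalence forces δ = 5.
  ordinary : d ℤ.≤ + 9 ⊎ + 25 ℤ.< d → k ≢ 5 → Dichotomy A d k

dichotomy? : ∀ {A} → Dec A → ∀ d k → Dec (Dichotomy A d k)
dichotomy? A? d k = map′
  (λ { (inj₁ (d≡25 , k≡5 , a)) → extremal d≡25 k≡5 a ; (inj₂ (range , k≢5)) → ordinary range k≢5 })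
  (λ { (extremal d≡25 k≡5 a) → inj₁ (d≡25 , k≡5 , a) ; (ordinary range k≢5) → inj₂ (range , k≢5) })
  -- With `A?` in last place, the search for an alignment runs only when both numbers are extremal.
  ((d ℤ.≟ + 25 ×-dec k ℕ.≟ 5 ×-dec A?) ⊎-dec
   ((d ℤ.≤? + 9 ⊎-dec + 25 ℤ.<? d) ×-dec ¬? (k ℕ.≟ 5)))

wedgeDet : ∀ {n} → Tournament n → ℤ
wedgeDet T = top (rowWedge (skew T))

wedgeDet-cone : ∀ {n} (T : Tournament (suc n)) → wedgeDet (cone (sourceCode T)) ≡ detT T
wedgeDet-cone T = trans (sym (det≡top (skew (cone (sourceCode T))))) (sym (detT-cone T))

abstract
  -- The exhaustive check of the 2¹⁰ codes, kept abstract so that later type checking does not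
  -- unfold it.
  cone-dichotomy : ∀ (u : Upper 5) → Dichotomy (Alignable (cone u)) (wedgeDet (cone u)) (δ₆ (cone u))
  cone-dichotomy = decide (allUpper? {5} λ u →
    dichotomy? (alignable? (cone u)) (wedgeDet (cone u)) (δ₆ (cone u))) refl

-- Successive switchings compose by symmetric difference of their vertex sets.
switchRel-∘ : ∀ {n} (r : Fin n → Fin n → Bool) V W i j →
  switchRel r (λ k → V k xor W k) i j ≡ switchRel (switchRel r V) W i j
switchRel-∘ r V W i j = begin
  switchRel r (λ k → V k xor W k) i j
    ≡⟨ switchRel-xor r (λ k → V k xor W k) i j ⟩
  ((V i xor W i) xor (V j xor W j)) xor r i j
    ≡⟨ solve 5 (λ v w v′ w′ b → ((v :+ w) :+ (v′ :+ w′)) :+ b := (w :+ w′) :+ ((v :+ v′) :+ b))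
         refl (V i) (W i) (V j) (W j) (r i j) ⟩
  (W i xor W j) xor ((V i xor V j) xor r i j)
    ≡⟨ cong ((W i xor W j) xor_) (switchRel-xor r V i j) ⟨
  (W i xor W j) xor switchRel r V i j
    ≡⟨ switchRel-xor (switchRel r V) W i j ⟨
  switchRel (switchRel r V) W i j ∎
  where
  open ≡-Reasoning
  open xor-∧-Solver

switchRel-cong : ∀ {n} {r s : Fin n → Fin n → Bool} W i j → r i j ≡ s i j → switchRel r W i j ≡ switchRel s W i j
switchRel-cong W i j = cong (λ b → if W i xor W j then not b else b)

switchEquivL6-switch : ∀ T V S → switch T V ≗ᵀ S → SwitchEquivL6 S → SwitchEquivL6 T
switchEquivL6-switch T V S TV≗S (W , σ , e) = (λ k → V k xor W k) , σ , λ i j i≢j →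
  trans (switchRel-∘ (beats T) V W (σ ⟨$⟩ʳ i) (σ ⟨$⟩ʳ j))
        (trans (switchRel-cong {r = switchRel (beats T) V} {beats S} W _ _ (TV≗S _ _)) (e i j i≢j))

switchEquivL6-iso : ∀ S T (π : Permutation′ 6) → (∀ i j → beats S i j ≡ beats T (π ⟨$⟩ʳ i) (π ⟨$⟩ʳ j)) →
  SwitchEquivL6 S → SwitchEquivL6 T
switchEquivL6-iso S T π S≅T (W , σ , e) = W ∘ (π ⟨$⟩ˡ_) , σ ∘ₚ π , λ i j i≢j →
  trans (along (σ ⟨$⟩ʳ i) (σ ⟨$⟩ʳ j)) (e i j i≢j)
  where
  along : ∀ i j → switchRel (beats T) (W ∘ (π ⟨$⟩ˡ_)) (π ⟨$⟩ʳ i) (π ⟨$⟩ʳ j) ≡ switchRel (beats S) W i j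
  along i j rewrite inverseˡ π {i} | inverseˡ π {j} | S≅T i j = refl

-- The switched tournament is L₆ relabelled by the inverse of σ, one of the 720 cases already
-- counted.
switchEquivL6⇒δ₆≡5 : ∀ T → SwitchEquivL6 T → δ₆ T ≡ 5
switchEquivL6⇒δ₆≡5 T (W , σ , e) = begin
  δ₆ T               ≡⟨ δ₆-switch T W ⟨
  δ₆ (switch T W)    ≡⟨ δ₆-cong L (switch T W) L≗TW ⟨
  δ₆ L               ≡⟨ δ₆-L6 v v-unique ⟩
  5                  ∎
  where
  open ≡-Reasoning
  v = tabulate (σ ⟨$⟩ˡ_)
  v-unique : Unique v
  v-unique = tabulate⁺ λ {i} {j} σ⁻¹i≡σ⁻¹j →
    trans (sym (inverseʳ σ)) (trans (cong (σ ⟨$⟩ʳ_) σ⁻¹i≡σ⁻¹j) (inverseʳ σ))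
  L = decode (encode λ i j → L6beats (lookup v i) (lookup v j))
  onL6 : ∀ i j → switchRel (beats T) W (σ ⟨$⟩ʳ i) (σ ⟨$⟩ʳ j) ≡ L6beats i j
  onL6 i j with i ≟ j
  -- The equivalence says nothing about the diagonal, where both relations are false.
  ... | yes refl = trans (irrefl (switch T W) (σ ⟨$⟩ʳ i)) (sym (L6-irrefl i))
  ... | no  i≢j  = e i j i≢j
  L≗TW : L ≗ᵀ switch T W
  L≗TW i j = begin
    beats L i j
      ≡⟨ decode-encode (pull L6 (mk↣ (lookup-injective v-unique _ _))) i j ⟩
    L6beats (lookup v i) (lookup v j)
      ≡⟨ cong₂ L6beats (lookup∘tabulate (σ ⟨$⟩ˡ_) i) (lookup∘tabulate (σ ⟨$⟩ˡ_) j) ⟩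
    L6beats (σ ⟨$⟩ˡ i) (σ ⟨$⟩ˡ j)
      ≡⟨ onL6 _ _ ⟨
    switchRel (beats T) W (σ ⟨$⟩ʳ (σ ⟨$⟩ˡ i)) (σ ⟨$⟩ʳ (σ ⟨$⟩ˡ j))
      ≡⟨ cong₂ (switchRel (beats T) W) (inverseʳ σ) (inverseʳ σ) ⟩
    switchRel (beats T) W i j ∎

dichotomy-map : ∀ {A B d k} → (A → B) → Dichotomy A d k → Dichotomy B d k
dichotomy-map f (extremal d≡25 k≡5 a) = extremal d≡25 k≡5 (f a)
dichotomy-map f (ordinary range k≢5)  = ordinary range k≢5

25≰9 : ¬ (+ 25 ℤ.≤ + 9)
25≰9 = ℤ.<⇒≱ (decide (+ 9 ℤ.<? + 25) refl)

d≡25⇒k≡5 : ∀ {A d k} → Dichotomy A d k → d ≡ + 25 → k ≡ 5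
d≡25⇒k≡5 (extremal _ k≡5 _)        _    = k≡5
d≡25⇒k≡5 (ordinary (inj₁ d≤9) _)   refl = contradiction d≤9 25≰9
d≡25⇒k≡5 (ordinary (inj₂ 25<d) _)  refl = contradiction 25<d (ℤ.<-irrefl refl)

k≡5⇒d≡25 : ∀ {A d k} → Dichotomy A d k → k ≡ 5 → d ≡ + 25
k≡5⇒d≡25 (extremal d≡25 _ _) _   = d≡25
k≡5⇒d≡25 (ordinary _ k≢5)    k≡5 = contradiction k≡5 k≢5

k≡5⇒A : ∀ {A d k} → Dichotomy A d k → k ≡ 5 → A
k≡5⇒A (extremal _ _ a)  _   = a
k≡5⇒A (ordinary _ k≢5)  k≡5 = contradiction k≡5 k≢5

A⊎k≢5 : ∀ {A d k} → Dichotomy A d k → A ⊎ k ≢ 5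
A⊎k≢5 (extremal _ _ a)  = inj₁ a
A⊎k≢5 (ordinary _ k≢5)  = inj₂ k≢5

d≤25⇒d≤9 : ∀ {A d k} → Dichotomy A d k → ¬ A → d ℤ.≤ + 25 → d ℤ.≤ + 9
d≤25⇒d≤9 (extremal _ _ a)            ¬a _     = contradiction a ¬a
d≤25⇒d≤9 (ordinary (inj₁ d≤9) _)     ¬a _     = d≤9
d≤25⇒d≤9 (ordinary (inj₂ 25<d) _)    ¬a d≤25  = contradiction d≤25 (ℤ.<⇒≱ 25<d)

dichotomy : ∀ T → Dichotomy (SwitchEquivL6 T) (detT T) (δ T)
dichotomy T = subst₂ (Dichotomy (SwitchEquivL6 T)) (wedgeDet-cone T) (sym (trans (δ≡δ₆ T) (δ₆-cone T)))
  (dichotomy-map (switchEquivL6-switch T (sourceSwitch T) C (switch≗cone T) ∘ alignable⇒switchEquivL6 C)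
                 (cone-dichotomy (sourceCode T)))
  where C = cone (sourceCode T)

-- Membership in D₃ and D₅

wedgeDet-cone≤9 : ∀ m → m ℕ.< 5 → (u : Upper m) → wedgeDet (cone u) ℤ.≤ + 9
-- The source is an additional vertex, so these cases cover the sizes 1 to 5.
wedgeDet-cone≤9 0 _ = decide (allUpper? {0} λ u → wedgeDet (cone u) ℤ.≤? + 9) refl
wedgeDet-cone≤9 1 _ = decide (allUpper? {1} λ u → wedgeDet (cone u) ℤ.≤? + 9) refl
wedgeDet-cone≤9 2 _ = decide (allUpper? {2} λ u → wedgeDet (cone u) ℤ.≤? + 9) refl
wedgeDet-cone≤9 3 _ = decide (allUpper? {3} λ u → wedgeDet (cone u) ℤ.≤? + 9) refl
wedgeDet-cone≤9 4 _ = decide (allUpper? {4} λ u → wedgeDet (cone u) ℤ.≤? + 9) refl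
wedgeDet-cone≤9 (suc (suc (suc (suc (suc m))))) (s≤s (s≤s (s≤s (s≤s (s≤s ())))))

detT≤9 : ∀ {m} → m ℕ.< 5 → (T : Tournament (suc m)) → detT T ℤ.≤ + 9
detT≤9 {m} m<5 T = subst (ℤ._≤ + 9) (wedgeDet-cone T) (wedgeDet-cone≤9 m m<5 (sourceCode T))

-- Proper subtournaments have at most 5 vertices and so determinant at most 9, which leaves the
-- enumerations of all six vertices.
inD : ∀ k (T : Tournament 6) → 9 ℕ.≤ k ℕ.* k → (∀ (f : Fin 6 ↣ Fin 6) → detT (pull T f) ℤ.≤ + (k ℕ.* k)) → InD k T
inD k T 9≤k² spanning m f f-inj =
  subst (ℤ._≤ + (k ℕ.* k)) (sym (subDet-pull T (mk↣ f-inj)))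
    (Sum.[ proper (mk↣ f-inj) , full (mk↣ f-inj) ]′ (ℕ.m≤n⇒m<n∨m≡n (injective⇒≤ f-inj)))
  where
  proper : ∀ {m} (f : Fin (suc m) ↣ Fin 6) → suc m ℕ.< 6 → detT (pull T f) ℤ.≤ + (k ℕ.* k)
  proper f (s≤s m<5) = ℤ.≤-trans (detT≤9 m<5 (pull T f)) (+≤+ 9≤k²)
  full : ∀ {m} (f : Fin m ↣ Fin 6) → m ≡ 6 → detT (pull T f) ℤ.≤ + (k ℕ.* k)
  full f refl = spanning f

InD⇒detT≤ : ∀ {k n} (T : Tournament (suc n)) → InD k T → detT T ℤ.≤ + (k ℕ.* k)
InD⇒detT≤ T T∈Dₖ = T∈Dₖ _ id id

switchEquivL6⇒δ≡5 : ∀ T → SwitchEquivL6 T → δ T ≡ 5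
switchEquivL6⇒δ≡5 T T~L6 = trans (δ≡δ₆ T) (switchEquivL6⇒δ₆≡5 T T~L6)

switchEquivL6⇒det≡25 : ∀ T → SwitchEquivL6 T → detT T ≡ + 25
switchEquivL6⇒det≡25 T = k≡5⇒d≡25 (dichotomy T) ∘ switchEquivL6⇒δ≡5 T

switchEquivL6-pull : ∀ T f → SwitchEquivL6 T → SwitchEquivL6 (pull T f)
switchEquivL6-pull T f with injection⇒permutation f
... | π , π≗f = switchEquivL6-iso T (pull T f) (flip π) λ i j → sym (cong₂ (beats T)
  (trans (sym (π≗f _)) (inverseʳ π)) (trans (sym (π≗f _)) (inverseʳ π)))

switchEquivL6-unpull : ∀ T f → SwitchEquivL6 (pull T f) → SwitchEquivL6 T
switchEquivL6-unpull T f with injection⇒permutation f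
... | π , π≗f = switchEquivL6-iso (pull T f) T π λ i j → sym (cong₂ (beats T) (π≗f i) (π≗f j))

-- Each enumeration of all six vertices yields an isomorphic copy of `T`, again equivalent to L₆, so
-- the dichotomy gives it determinant 25. The invariance of determinants under relabelling is thus
-- obtained through the equivalence.
switchEquivL6⇒InD5 : ∀ T → SwitchEquivL6 T → InD 5 T
switchEquivL6⇒InD5 T T~L6 = inD 5 T (decide (9 ℕ.≤? 25) refl) λ f →
  ℤ.≤-reflexive (switchEquivL6⇒det≡25 (pull T f) (switchEquivL6-pull T f T~L6))

switchEquivL6⇒¬InD3 : ∀ T → SwitchEquivL6 T → ¬ InD 3 T
switchEquivL6⇒¬InD3 T T~L6 T∈D₃ =
  25≰9 (subst (ℤ._≤ + 9) (switchEquivL6⇒det≡25 T T~L6) (InD⇒detT≤ {3} T T∈D₃))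

-- No relabelled copy of `T` is equivalent to L₆, since `T` would then have δ = 5. Its determinant
-- is at most 25, and the gap between 9 and 25 lowers this bound to 9.
InD5⇒InD3 : ∀ T → δ T ≢ 5 → InD 5 T → InD 3 T
InD5⇒InD3 T δ≢5 T∈D₅ = inD 3 T ℕ.≤-refl λ f → d≤25⇒d≤9 (dichotomy (pull T f))
  (δ≢5 ∘ switchEquivL6⇒δ≡5 T ∘ switchEquivL6-unpull T f)
  (subst (ℤ._≤ + 25) (subDet-pull T f) (T∈D₅ 5 (f ↣$_) (Injection.injective f)))

InD5∖D3⇒switchEquivL6 : ∀ T → InD 5 T → ¬ InD 3 T → SwitchEquivL6 T
InD5∖D3⇒switchEquivL6 T T∈D₅ T∉D₃ =
  -- The dichotomy supplies the case distinction constructively, with a witness of the equivalence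
  -- in the first case.
  Sum.[ id , (λ δ≢5 → contradiction (InD5⇒InD3 T δ≢5 T∈D₅) T∉D₃) ]′ (A⊎k≢5 (dichotomy T))

theorem2p11 : (T : Tournament 6) →
    ((detT T ≡ + 25) ⇔ (δ T ≡ 5)) ×
    ((δ T ≡ 5) ⇔ SwitchEquivL6 T) ×
    (SwitchEquivL6 T ⇔ (InD 5 T × ¬ InD 3 T))
theorem2p11 T =
  mk⇔ (d≡25⇒k≡5 (dichotomy T)) (k≡5⇒d≡25 (dichotomy T)) ,
  mk⇔ (k≡5⇒A (dichotomy T)) (switchEquivL6⇒δ≡5 T) ,
  mk⇔ (λ T~L6 → switchEquivL6⇒InD5 T T~L6 , switchEquivL6⇒¬InD3 T T~L6)
      (uncurry (InD5∖D3⇒switchEquivL6 T))
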